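{- For every tree $T$ on $k$ vertices, $\mathrm{ex}_c(n,T)\ge \lfloor \frac{k}{6}\rfloor n$ for all sufficiently large $n$.
   Context: $\mathrm{ex}_c(n,F)$ denotes the largest number of edges in a connected $n$-vertex graph containing no subgraph isomorphic to $F$. -}

module Defs where

open import Data.Nat using (ℕ; zero; suc; _+_; _*_; _≤_; _<ᵇ_; _/_)
open import Data.Bool using (Bool; true; false; if_then_else_; _∧_)
open import Data.Fin using (Fin; toℕ; inject₁; fromℕ)
open import Data.List using (List; map; allFin; concatMap)
open import Data.Nat.ListAction using (sum)
open import Data.Product using (Σ; ∃; _×_; _,_)
open import Data.Sum using (_⊎_)
open import Function.Definitions using (Injective)
open import Relation.Binary.PropositionalEquality using (_≡_)
open import Relation.Nullary using (¬_)

record Graph (n : ℕ) : Set where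
  field
    adj  : Fin n → Fin n → Bool
    sym  : ∀ u v → adj u v ≡ adj v u
    irr  : ∀ v → adj v v ≡ false
open Graph public

Adj : ∀ {n} → Graph n → Fin n → Fin n → Set
Adj G u v = adj G u v ≡ true

edges : ∀ {n} → Graph n → ℕ
edges {n} G =
  sum (concatMap (λ i → map (λ j → if (toℕ i <ᵇ toℕ j) ∧ adj G i j then 1 else 0)
                            (allFin n))
                 (allFin n))

data Walk {n} (G : Graph n) : Fin n → Fin n → Set where
  here : ∀ {v} → Walk G v v
  step : ∀ {u v w} → Adj G u v → Walk G v w → Walk G u w

Connected : ∀ {n} → Graph n → Set
Connected G = ∀ u v → Walk G u v

record Cycle {n} (G : Graph n) : Set where
  field
    len     : ℕ
    p       : Fin (suc (suc (suc len))) → Fin n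
    inj     : Injective _≡_ _≡_ p
    consec  : ∀ (i : Fin (suc (suc len))) → Adj G (p (inject₁ i)) (p (Fin.suc i))
    closing : Adj G (p (fromℕ (suc (suc len)))) (p Fin.zero)

Acyclic : ∀ {n} → Graph n → Set
Acyclic G = ¬ Cycle G

IsTree : ∀ {k} → Graph k → Set
IsTree T = Connected T × Acyclic T

Contains : ∀ {n k} → Graph n → Graph k → Set
Contains {n} {k} G F =
  Σ (Fin k → Fin n) λ f → Injective _≡_ _≡_ f × (∀ u v → Adj F u v → Adj G (f u) (f v))

-- "ex_c(n, F) ≥ b": the maximum number of edges of a connected F-free graph
-- on n vertices is at least b.  Convention: the max over the empty family is 0
-- (so the bound b = 0 holds trivially).
ExcAtLeast : ∀ {k} → (n : ℕ) → Graph k → ℕ → Set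
ExcAtLeast n F b =
  b ≡ 0 ⊎ Σ (Graph n) λ G → Connected G × ¬ Contains G F × b ≤ edges G

{-# OPTIONS --safe #-}

-- Put m = ⌊k/6⌋ and d = 2m, and distinguish whether T has a vertex x such that all components of T − x have at most d vertices.
-- If not, T does not embed in a graph made of copies of K_d with one further vertex joined to everything, as the preimage of that vertex
-- would be such an x. Its edge density is m + 1/2, which absorbs the deficit of an incomplete last clique.
-- If so, take a chain that starts with K_{4m−1} and continues with copies of K_{2m+1}, each minus an edge yz, where y is linked by an edge
-- to the previous block and z to the next one. This has m edges per vertex, the surplus of the first block absorbing the deficit of an
-- incomplete last block. Suppose that T embeds and consider the block Q that contains x. The part of T on one side of Q is attached to Q
-- through a single vertex, y or z, so it lies in one component of T − x; if x is not that vertex, this component also contains it, and even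
-- another vertex of Q when x is the other end, because yz is not an edge. So both sides together have at most 2d − 2 vertices, and
-- k ≤ (2m + 1) + (2d − 2) < 6m, a contradiction. The first block has only one side, and k ≤ (4m − 1) + d < 6m.
module Submission where

open import Defs hiding (sym)
open import Data.Nat using (ℕ; _≤_; _*_; _/_)
open import Data.Product using (Σ)

open import Data.Bool using (Bool; true; false; if_then_else_; _∧_; _∨_; T)
import Data.Bool.Properties as Bool
open import Data.Bool.Properties using (∨-comm)
open import Data.Fin as Fin using (Fin; toℕ)
import Data.Fin.Properties as Fin
open import Data.Fin.Properties using (all?; any?; toℕ-injective; toℕ<n)
open import Data.Fin.Subset using (Subset; _∈_; ∣_∣; _∪_; _-_; ⁅_⁆) renaming (⊤ to full)
open import Data.Fin.Subset.Properties
open import Data.List using (List; []; _∷_; map; allFin; concatMap; tabulate)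
open import Data.List.Properties using (map-tabulate; map-cong)
open import Data.Nat using (zero; suc; _+_; _∸_; _<_; _%_; _⊔_; _⊓_; _<ᵇ_; _≤ᵇ_; _≡ᵇ_; _≤?_; _<?_; z≤n; s≤s; NonZero)
open import Data.Nat.DivMod
open import Data.Nat.ListAction using (sum)
open import Data.Nat.ListAction.Properties using (sum-++)
open import Data.Nat.Properties
open import Data.Nat.Tactic.RingSolver using (solve-∀)
open import Data.Product using (_×_; _,_; proj₁; proj₂)
open import Data.Sum using (_⊎_; inj₁; inj₂)
import Data.Vec as Vec
open import Data.Vec.Properties using (lookup⇒[]=; []=⇒lookup; lookup∘tabulate)
open import Function using (_∘_; id)
open import Function.Definitions using (Injective)
open import Level using (0ℓ)
open import Relation.Binary.PropositionalEquality
open import Relation.Nullary using (¬_; yes; no; does; contradiction; ¬?)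
open import Relation.Nullary.Decidable using (_×-dec_; _→-dec_; dec-true; dec-false)
open import Relation.Unary using (Pred; Decidable)

-- Sums over initial segments and over lists.

∑ : (ℕ → ℕ) → ℕ → ℕ
∑ f zero    = 0
∑ f (suc n) = ∑ f n + f n

∑-split : ∀ f a n → ∑ f (a + n) ≡ ∑ f a + ∑ (λ t → f (a + t)) n
∑-split f a zero    = trans (cong (∑ f) (+-identityʳ a)) (sym (+-identityʳ _))
∑-split f a (suc n) = begin
  ∑ f (a + suc n)                                     ≡⟨ cong (∑ f) (+-suc a n) ⟩
  ∑ f (a + n) + f (a + n)                             ≡⟨ cong (_+ f (a + n)) (∑-split f a n) ⟩
  ∑ f a + ∑ (λ t → f (a + t)) n + f (a + n)           ≡⟨ +-assoc (∑ f a) _ _ ⟩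
  ∑ f a + ∑ (λ t → f (a + t)) (suc n)                 ∎
  where open ≡-Reasoning

∑-mono-≤ : ∀ {f g} n → (∀ t → t < n → f t ≤ g t) → ∑ f n ≤ ∑ g n
∑-mono-≤ zero    f≤g = z≤n
∑-mono-≤ (suc n) f≤g = +-mono-≤ (∑-mono-≤ n λ t t<n → f≤g t (m<n⇒m<1+n t<n)) (f≤g n ≤-refl)

∑-+ : ∀ f g n → ∑ (λ t → f t + g t) n ≡ ∑ f n + ∑ g n
∑-+ f g zero    = refl
∑-+ f g (suc n) = trans (cong (_+ (f n + g n)) (∑-+ f g n)) (interchange (∑ f n) (∑ g n) (f n) (g n))
  where
  interchange : ∀ a b c d → a + b + (c + d) ≡ a + c + (b + d)
  interchange = solve-∀

∑-positive : ∀ {f} n → (∀ t → t < n → 1 ≤ f t) → n ≤ ∑ f n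
∑-positive zero    1≤f = z≤n
∑-positive {f} (suc n) 1≤f = subst (_≤ ∑ f (suc n)) (+-comm n 1)
  (+-mono-≤ (∑-positive n λ t t<n → 1≤f t (m<n⇒m<1+n t<n)) (1≤f n ≤-refl))

∑-positive-tail : ∀ {f} a n → (∀ t → t < n → 1 ≤ f (a + t)) → n ≤ ∑ f (a + n)
∑-positive-tail {f} a n 1≤f =
  subst (n ≤_) (sym (∑-split f a n)) (≤-trans (∑-positive n 1≤f) (m≤n+m _ _))

-- Meant for back-degrees in a graph made of an initial piece of `a` vertices, `q` blocks of `d` and
-- an incomplete one of `r`: `g` is a bound that depends only on the offset within a block.
∑-periodic : ∀ F g a d q r → r ≤ d → (∀ q t → t < d → g t ≤ F (a + (q * d + t))) →
  ∑ F a + (q * ∑ g d + ∑ g r) ≤ ∑ F (a + (q * d + r))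
∑-periodic F g a d q r r≤d g≤F = begin
  ∑ F a + (q * ∑ g d + ∑ g r)          ≤⟨ +-monoʳ-≤ (∑ F a) (+-mono-≤ (blocks q) (block q r r≤d)) ⟩
  ∑ F a + (∑ G (q * d) + ∑ (λ t → G (q * d + t)) r) ≡⟨ cong (∑ F a +_) (sym (∑-split G (q * d) r)) ⟩
  ∑ F a + ∑ G (q * d + r)              ≡⟨ sym (∑-split F a (q * d + r)) ⟩
  ∑ F (a + (q * d + r))                ∎
  where
  open ≤-Reasoning
  G : ℕ → ℕ
  G t = F (a + t)
  block : ∀ q r → r ≤ d → ∑ g r ≤ ∑ (λ t → G (q * d + t)) r
  block q r r≤d = ∑-mono-≤ r λ t t<r → g≤F q t (<-≤-trans t<r r≤d)
  blocks : ∀ q → q * ∑ g d ≤ ∑ G (q * d)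
  blocks zero    = z≤n
  blocks (suc q) = begin
    ∑ g d + q * ∑ g d                              ≡⟨ +-comm (∑ g d) _ ⟩
    q * ∑ g d + ∑ g d                              ≤⟨ +-mono-≤ (blocks q) (block q d ≤-refl) ⟩
    ∑ G (q * d) + ∑ (λ t → G (q * d + t)) d        ≡⟨ sym (∑-split G (q * d) d) ⟩
    ∑ G (q * d + d)                                ≡⟨ cong (∑ G) (+-comm (q * d) d) ⟩
    ∑ G (suc q * d)                                ∎

-- Each of the first m = suc p terms falls short of m by at most p, and no later one falls short.
prefix-deficit : ∀ p g d → (∀ t → 1 ≤ g t) → (∀ t → suc p ≤ t → t < d → suc p ≤ g t) →
  ∀ r → r ≤ d → suc p * r ≤ ∑ g r + suc p * p
prefix-deficit p g d 1≤g m≤g zero    _     = ≤-trans (≤-reflexive (*-zeroʳ (suc p))) z≤n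
prefix-deficit p g d 1≤g m≤g (suc r) sr≤d with suc p ≤? r
... | yes m≤r = begin
  suc p * suc r                  ≡⟨ *-suc (suc p) r ⟩
  suc p + suc p * r              ≤⟨ +-mono-≤ (m≤g r m≤r sr≤d) (prefix-deficit p g d 1≤g m≤g r (<⇒≤ sr≤d)) ⟩
  g r + (∑ g r + suc p * p)      ≡⟨ rotate (g r) (∑ g r) (suc p * p) ⟩
  ∑ g r + g r + suc p * p        ∎
  where
  open ≤-Reasoning
  rotate : ∀ a b c → a + (b + c) ≡ b + a + c
  rotate = solve-∀
... | no  m≰r = begin
  suc p * suc r                  ≡⟨ cong (suc r +_) (*-comm p (suc r)) ⟩
  suc r + suc r * p              ≤⟨ +-mono-≤ (∑-positive {g} (suc r) λ t _ → 1≤g t) (*-monoˡ-≤ p (≰⇒> m≰r)) ⟩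
  ∑ g (suc r) + suc p * p        ∎
  where open ≤-Reasoning

sum-concatMap : ∀ {A : Set} (g : A → List ℕ) xs → sum (concatMap g xs) ≡ sum (map (sum ∘ g) xs)
sum-concatMap g []       = refl
sum-concatMap g (x ∷ xs) = trans (sum-++ (g x) _) (cong (sum (g x) +_) (sum-concatMap g xs))

sum-tabulate-toℕ : ∀ f n → sum (tabulate {n = n} (f ∘ toℕ)) ≡ ∑ f n
sum-tabulate-toℕ f zero    = refl
sum-tabulate-toℕ f (suc n) = trans (cong (f 0 +_) (sum-tabulate-toℕ (f ∘ suc) n)) (sym (∑-split f 1 n))

sum-allFin : ∀ f n → sum (map (f ∘ toℕ) (allFin n)) ≡ ∑ f n
sum-allFin f n = trans (cong sum (map-tabulate {n = n} id (f ∘ toℕ))) (sum-tabulate-toℕ f n)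

-- Graphs from a relation on the naturals, and their edge counts.

-- One relation on all naturals yields the graphs of every order by restriction, so an incomplete
-- last block needs no construction of its own.
Rel : Set
Rel = ℕ → ℕ → Bool

joined : Rel → Rel
joined R i j = ((i <ᵇ j) ∧ R i j) ∨ ((j <ᵇ i) ∧ R j i)

<ᵇ-irrefl : ∀ i → (i <ᵇ i) ≡ false
<ᵇ-irrefl zero    = refl
<ᵇ-irrefl (suc i) = <ᵇ-irrefl i

<⇒<ᵇ≡true : ∀ {i j} → i < j → (i <ᵇ j) ≡ true
<⇒<ᵇ≡true {i} {j} = dec-true (i <? j)

≤⇒≤ᵇ≡true : ∀ {i j} → i ≤ j → (i ≤ᵇ j) ≡ true
≤⇒≤ᵇ≡true {i} {j} = dec-true (i ≤? j)

-- Only the values R i j with i < j matter.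
initialGraph : Rel → ∀ n → Graph n
initialGraph R n = record
  { adj = λ u v → joined R (toℕ u) (toℕ v)
  ; sym = λ u v → ∨-comm ((toℕ u <ᵇ toℕ v) ∧ R (toℕ u) (toℕ v)) _
  ; irr = λ v → joined-irrefl (toℕ v)
  }
  where
  joined-irrefl : ∀ i → joined R i i ≡ false
  joined-irrefl i rewrite <ᵇ-irrefl i = refl

joined⁺ : ∀ R {i j} → i < j → R i j ≡ true → joined R i j ≡ true
joined⁺ R i<j Rij rewrite <⇒<ᵇ≡true i<j | Rij = refl

∧-true : ∀ {a b} → a ∧ b ≡ true → a ≡ true × b ≡ true
∧-true {true} {true} _ = refl , refl

joined⁻ : ∀ R {i j} → joined R i j ≡ true → (i < j × R i j ≡ true) ⊎ (j < i × R j i ≡ true)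
joined⁻ R {i} {j} e with (i <ᵇ j) ∧ R i j in eq
... | true  = let l , r = ∧-true eq in inj₁ (<ᵇ⇒< i j (subst T (sym l) _) , r)
... | false = let l , r = ∧-true e  in inj₂ (<ᵇ⇒< j i (subst T (sym l) _) , r)

module _ (R : Rel) where

  private
    -- Matches the summand in `edges`, so that `edges-initialGraph` is only a conversion of list
    -- sums.
    entry : ℕ → ℕ → ℕ
    entry i j = if (i <ᵇ j) ∧ joined R i j then 1 else 0

  entry-positive : ∀ {i j} → i < j → R i j ≡ true → 1 ≤ entry i j
  entry-positive i<j Rij rewrite <⇒<ᵇ≡true i<j | Rij = ≤-refl

  -- Counting an edge at its larger end makes the contribution of a vertex independent of `n`.
  backDegree : ℕ → ℕ
  backDegree j = ∑ (λ i → entry i j) j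

  backDegree-tail : ∀ a n → (∀ t → t < n → R (a + t) (a + n) ≡ true) → n ≤ backDegree (a + n)
  backDegree-tail a n r = ∑-positive-tail a n λ t t<n → entry-positive (+-monoʳ-< a t<n) (r t t<n)

  -- The tail starts after vertex 0, so the edge to 0 counts in addition.
  backDegree-root-tail : ∀ a n → R 0 (suc (a + n)) ≡ true →
    (∀ t → t < n → R (suc (a + t)) (suc (a + n)) ≡ true) → suc n ≤ backDegree (suc (a + n))
  backDegree-root-tail a n r₀ r = subst (suc n ≤_) (sym (∑-split _ 1 (a + n)))
    (+-mono-≤ (entry-positive (s≤s z≤n) r₀)
      (∑-positive-tail a n λ t t<n → entry-positive (s≤s (+-monoʳ-< a t<n)) (r t t<n)))

  edges-initialGraph : ∀ n → edges (initialGraph R n) ≡ ∑ (λ i → ∑ (entry i) n) n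
  edges-initialGraph n = begin
    edges (initialGraph R n)
      ≡⟨ sum-concatMap (λ i → map (λ j → entry (toℕ i) (toℕ j)) (allFin n)) (allFin n) ⟩
    sum (map (λ i → sum (map (λ j → entry (toℕ i) (toℕ j)) (allFin n))) (allFin n))
      ≡⟨ cong sum (map-cong (λ i → sum-allFin (entry (toℕ i)) n) (allFin n)) ⟩
    sum (map (λ i → ∑ (entry (toℕ i)) n) (allFin n))
      ≡⟨ sum-allFin (λ i → ∑ (entry i) n) n ⟩
    ∑ (λ i → ∑ (entry i) n) n ∎
    where open ≡-Reasoning

  ∑-backDegree≤edges : ∀ n → ∑ backDegree n ≤ edges (initialGraph R n)
  ∑-backDegree≤edges n = subst (∑ backDegree n ≤_) (sym (edges-initialGraph n)) (go n)
    where
    open ≤-Reasoning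
    go : ∀ n → ∑ backDegree n ≤ ∑ (λ i → ∑ (entry i) n) n
    go zero    = z≤n
    go (suc n) = begin
      ∑ backDegree n + backDegree n                          ≤⟨ +-monoˡ-≤ _ (go n) ⟩
      ∑ (λ i → ∑ (entry i) n) n + ∑ (λ i → entry i n) n      ≡⟨ sym (∑-+ (λ i → ∑ (entry i) n) (λ i → entry i n) n) ⟩
      -- The dropped row `n` has no entry right of the diagonal in this range, so nothing is lost.
      ∑ (λ i → ∑ (entry i) (suc n)) n                        ≤⟨ m≤m+n _ _ ⟩
      ∑ (λ i → ∑ (entry i) (suc n)) (suc n)                  ∎

-- Walks and connectedness.

_++ʷ_ : ∀ {n} {G : Graph n} {u v w} → Walk G u v → Walk G v w → Walk G u w
here     ++ʷ q = q
step e p ++ʷ q = step e (p ++ʷ q)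

reverseʷ : ∀ {n} {G : Graph n} {u v} → Walk G u v → Walk G v u
reverseʷ           here               = here
reverseʷ {G = G} (step {u} {v} e p) = reverseʷ p ++ʷ step (trans (Graph.sym G v u) e) here

connected-from-root : ∀ {n} {G : Graph n} r → (∀ v → Walk G v r) → Connected G
connected-from-root r to u v = to u ++ʷ reverseʷ (to v)

-- Repeatedly moving to a smaller neighbour ends at vertex 0.
connected-parents : ∀ R → (∀ i → Σ ℕ λ i′ → i′ ≤ i × R i′ (suc i) ≡ true) → ∀ n → Connected (initialGraph R n)
connected-parents R parent zero    ()
connected-parents R parent (suc n) = connected-from-root Fin.zero λ v → to (toℕ v) v ≤-refl
  where
  -- The bound `b` drops at every move and makes the recursion structural.
  to : ∀ b (v : Fin (suc n)) → toℕ v ≤ b → Walk (initialGraph R (suc n)) v Fin.zero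
  to b       Fin.zero    _         = here
  to (suc b) (Fin.suc v) (s≤s v≤b) =
    let i′ , i′≤v , r = parent (toℕ v)
        i′<n = ≤-<-trans i′≤v (m<n⇒m<1+n (toℕ<n v))
        eq = Fin.toℕ-fromℕ< i′<n
    in step {v = Fin.fromℕ< i′<n}
         (trans (∨-comm ((suc (toℕ v) <ᵇ toℕ (Fin.fromℕ< i′<n)) ∧ _) _)
           (joined⁺ R (subst (_< suc (toℕ v)) (sym eq) (s≤s i′≤v)) (subst (λ i → R i (suc (toℕ v)) ≡ true) (sym eq) r)))
         (to b _ (≤-trans (≤-reflexive eq) (≤-trans i′≤v v≤b)))

-- Subsets cut out by decidable predicates, and their sizes.

module _ {k : ℕ} {P : Pred (Fin k) 0ℓ} where

  ⟦_⟧ : Decidable P → Subset k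
  ⟦ P? ⟧ = Vec.tabulate (does ∘ P?)

  ∈⟦⟧⁺ : (P? : Decidable P) → ∀ {u} → P u → u ∈ ⟦ P? ⟧
  ∈⟦⟧⁺ P? {u} Pu = lookup⇒[]= u _ (trans (lookup∘tabulate (does ∘ P?) u) (dec-true (P? u) Pu))

  ∈⟦⟧⁻ : (P? : Decidable P) → ∀ {u} → u ∈ ⟦ P? ⟧ → P u
  ∈⟦⟧⁻ P? {u} u∈ with P? u | trans (sym (lookup∘tabulate (does ∘ P?) u)) ([]=⇒lookup u∈)
  ... | yes Pu | _ = Pu

Empty⇒∣p∣≡0 : ∀ {k} {p : Subset k} → (∀ u → ¬ u ∈ p) → ∣ p ∣ ≡ 0
Empty⇒∣p∣≡0 {k} {p} empty = trans (cong ∣_∣ (Empty-unique {p = p} λ (u , u∈p) → empty u u∈p)) (∣⊥∣≡0 k)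

∣p∪q∣≤∣p∣+∣q∣ : ∀ {k} (p q : Subset k) → ∣ p ∪ q ∣ ≤ ∣ p ∣ + ∣ q ∣
∣p∪q∣≤∣p∣+∣q∣ Vec.[]          Vec.[]          = z≤n
∣p∪q∣≤∣p∣+∣q∣ (false Vec.∷ p) (false Vec.∷ q) = ∣p∪q∣≤∣p∣+∣q∣ p q
∣p∪q∣≤∣p∣+∣q∣ (false Vec.∷ p) (true  Vec.∷ q) = subst (suc ∣ p ∪ q ∣ ≤_) (sym (+-suc ∣ p ∣ ∣ q ∣)) (s≤s (∣p∪q∣≤∣p∣+∣q∣ p q))
∣p∪q∣≤∣p∣+∣q∣ (true  Vec.∷ p) (false Vec.∷ q) = s≤s (∣p∪q∣≤∣p∣+∣q∣ p q)
∣p∪q∣≤∣p∣+∣q∣ (true  Vec.∷ p) (true  Vec.∷ q) = s≤s (≤-trans (∣p∪q∣≤∣p∣+∣q∣ p q) (+-monoʳ-≤ ∣ p ∣ (n≤1+n ∣ q ∣)))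

∣p∣≤1+∣p-x∣ : ∀ {k} (p : Subset k) x → ∣ p ∣ ≤ suc ∣ p - x ∣
∣p∣≤1+∣p-x∣ p x = begin
  ∣ p ∣                      ≤⟨ p⊆q⇒∣p∣≤∣q∣ cover ⟩
  ∣ ⁅ x ⁆ ∪ (p - x) ∣         ≤⟨ ∣p∪q∣≤∣p∣+∣q∣ ⁅ x ⁆ (p - x) ⟩
  ∣ ⁅ x ⁆ ∣ + ∣ p - x ∣       ≡⟨ cong (_+ ∣ p - x ∣) (∣⁅x⁆∣≡1 x) ⟩
  suc ∣ p - x ∣              ∎
  where
  open ≤-Reasoning
  cover : ∀ {u} → u ∈ p → u ∈ ⁅ x ⁆ ∪ (p - x)
  cover {u} u∈p with u Fin.≟ x
  ... | yes refl = x∈p∪q⁺ (inj₁ (x∈⁅x⁆ x))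
  ... | no  u≢x  = x∈p∪q⁺ (inj₂ (x∈p∧x≢y⇒x∈p-y u∈p u≢x))

-- Induction on the length: injectivity leaves at most one vertex in position `a`; delete it and
-- shorten the interval from the left.
∣p∣≤-of-interval : ∀ {k} {φ : Fin k → ℕ} → Injective _≡_ _≡_ φ → ∀ s a (p : Subset k) →
  (∀ u → u ∈ p → a ≤ φ u × φ u < a + s) → ∣ p ∣ ≤ s
∣p∣≤-of-interval {φ = φ} inj zero a p within =
  ≤-reflexive (Empty⇒∣p∣≡0 {p = p} λ u u∈p → let a≤ , <a = within u u∈p in
    <-irrefl refl (≤-<-trans a≤ (subst (φ u <_) (+-identityʳ a) <a)))
∣p∣≤-of-interval {φ = φ} inj (suc s) a p within with any? (λ u → φ u ≟ a)
... | yes (x , refl) = ≤-trans (∣p∣≤1+∣p-x∣ p x) (s≤s (∣p∣≤-of-interval inj s (suc a) (p - x) λ u u∈ →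
        let u∈p = p─q⊆p p _ u∈
            a≤ , <a = within u u∈p
        in ≤∧≢⇒< a≤ (λ eq → contradiction (subst (_∈ p - x) (inj (sym eq)) u∈) (x∉p-x x))
         , subst (φ u <_) (+-suc a s) <a))
  where
  x∉p-x : ∀ x → ¬ x ∈ p - x
  -- Deleting `x` a second time would shrink the set, yet deletion is idempotent.
  x∉p-x x x∈ = <-irrefl refl (subst (λ q → ∣ q ∣ < ∣ p - x ∣) (p─q─q≡p─q p ⁅ x ⁆) (x∈p⇒∣p-x∣<∣p∣ x∈))
... | no  none = m≤n⇒m≤1+n (∣p∣≤-of-interval inj s (suc a) p λ u u∈p → let a≤ , <a = within u u∈p in
        ≤∧≢⇒< a≤ (λ eq → none (u , sym eq)) , subst (φ u <_) (+-suc a s) <a)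

-- Components left after deleting a vertex.

module Tree {k : ℕ} (T : Graph k) (connected : Connected T) where

  Adj-sym : ∀ {u v} → Adj T u v → Adj T v u
  Adj-sym {u} {v} uv = trans (Graph.sym T v u) uv

  -- Every component of T − x has at most s vertices.
  Scattered : ℕ → Fin k → Set
  Scattered s x = ∀ y → y ≢ x → Σ (Subset k) λ S →
    y ∈ S × ∣ S ∣ ≤ s × (∀ u v → u ∈ S → Adj T u v → v ≢ x → v ∈ S)

  -- Makes the main case distinction constructive: since `Scattered` asks for a closed set around
  -- `y` instead of the component itself, a finite search over subsets decides it.
  scattered? : ∀ s → Decidable (Scattered s)
  scattered? s x = all? λ y → ¬? (y Fin.≟ x) →-dec anySubset? λ S →
    (y ∈? S) ×-dec (∣ S ∣ ≤? s) ×-dec all? λ u → all? λ v →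
      (u ∈? S) →-dec ((adj T u v Bool.≟ true) →-dec (¬? (v Fin.≟ x) →-dec (v ∈? S)))

  closed⇒full : ∀ {P : Pred (Fin k) 0ℓ} → (∀ {u v} → P u → Adj T u v → P v) → ∀ {u} → P u → ∀ v → P v
  closed⇒full {P} closed {u} Pu v = go (connected u v) Pu
    where
    go : ∀ {u v} → Walk T u v → P u → P v
    go here       Pu = Pu
    go (step e w) Pu = go w (closed Pu e)

  module _ {P : Pred (Fin k) 0ℓ} (P? : Decidable P) where

    exit : ∀ {u v} → Walk T u v → P u → ¬ P v → Σ (Fin k) λ a → Σ (Fin k) λ b → P a × ¬ P b × Adj T a b
    exit here Pu ¬Pu = contradiction Pu ¬Pu
    exit (step {u} {v} e w) Pu ¬Pw with P? v
    ... | yes Pv = exit w Pv ¬Pw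
    ... | no ¬Pv = u , v , Pu , ¬Pv , e

  -- Treats both sides of a block at once: `α` and `β` will be the two positions next to a block
  -- boundary, in either order, with `α` on the side being measured.
  module Side {φ : Fin k → ℕ} (inj : Injective _≡_ _≡_ φ) (α β : ℕ) where

    -- Lower bounds on the distance from x to the vertex in position β.
    data Gap (x : Fin k) : ℕ → Set where
      at   : Gap x 0
      off  : φ x ≢ β → Gap x 1
      far  : φ x ≢ β → (∀ b → φ b ≡ β → ¬ Adj T b x) → Gap x 2

    module _ {P : Pred (Fin k) 0ℓ} (P? : Decidable P) {x : Fin k} (¬Px : ¬ P x)
      (crossing : ∀ {u v} → P u → ¬ P v → Adj T u v → φ u ≡ α × φ v ≡ β) where

      -- The component of T − x that contains P also contains the entry b of P, unless b = x, and, if b is moreover not adjacent to x,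
      -- the next vertex outside P on a path from b to x.
      side-bound : ∀ {s g} → Scattered s x → 2 ≤ s → Gap x g → g + ∣ ⟦ P? ⟧ ∣ ≤ s
      side-bound {s} {g} scattered 2≤s gap with any? P?
      -- An empty side leaves only the gap, which is at most 2.
      ... | no  none = ≤-trans (≤-reflexive (trans (cong (g +_) (Empty⇒∣p∣≡0 λ u u∈ → none (u , ∈⟦⟧⁻ P? u∈))) (+-identityʳ g)))
                         (≤-trans (g≤2 gap) 2≤s)
        where
        g≤2 : ∀ {g} → Gap x g → g ≤ 2
        g≤2 at        = z≤n
        g≤2 (off _)   = s≤s z≤n
        g≤2 (far _ _) = ≤-refl
      ... | yes (u₀ , Pu₀) with exit P? (connected u₀ x) Pu₀ ¬Px
      ... | a , b , Pa , ¬Pb , ab with scattered a (λ { refl → ¬Px Pa })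
      ... | S , a∈S , ∣S∣≤s , closed = bound gap
        where
        φa≡α = proj₁ (crossing Pa ¬Pb ab)
        φb≡β = proj₂ (crossing Pa ¬Pb ab)

        -- A walk leaves `P` only from position `α`, that is from `a`. Read backwards from there it
        -- stays in `P`, hence off `x`, and closedness carries `S` along.
        P⊆S : ∀ {u v} → Walk T u v → P u → ¬ P v → u ∈ S
        P⊆S here Pu ¬Pu = contradiction Pu ¬Pu
        P⊆S (step {u} {v} e w) Pu ¬Pw with P? v
        ... | yes Pv = closed v u (P⊆S w Pv ¬Pw) (Adj-sym e) (λ { refl → ¬Px Pu })
        ... | no ¬Pv = subst (_∈ S) (inj (trans φa≡α (sym (proj₁ (crossing Pu ¬Pv e))))) a∈S

        inS : ∀ {u} → u ∈ ⟦ P? ⟧ → u ∈ S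
        inS {u} u∈ = P⊆S (connected u x) (∈⟦⟧⁻ P? u∈) ¬Px

        avoid : ∀ {u v} → u ∈ ⟦ P? ⟧ → ¬ P v → u ≢ v
        avoid u∈ ¬Pv refl = ¬Pv (∈⟦⟧⁻ P? u∈)

        b∈S : φ x ≢ β → b ∈ S
        b∈S φx≢β = closed a b a∈S ab (λ { refl → φx≢β φb≡β })

        -- Follow the walk while it stays in `P` or at `b`. From `P` it can exit only to `b`, so the
        -- first other vertex is a neighbour of `b`; it is not `x`, because `b` and `x` are not
        -- adjacent.
        second : φ x ≢ β → (∀ b → φ b ≡ β → ¬ Adj T b x) → ∀ {u} → Walk T u x → P u ⊎ u ≡ b →
          Σ (Fin k) λ v → ¬ P v × v ≢ b × v ∈ S
        second φx≢β b≁x here (inj₁ Px)   = contradiction Px ¬Px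
        second φx≢β b≁x here (inj₂ refl) = contradiction φb≡β φx≢β
        second φx≢β b≁x (step {u} {v} e w) u∈ with P? v | v Fin.≟ b
        ... | yes Pv | _        = second φx≢β b≁x w (inj₁ Pv)
        ... | no _   | yes v≡b  = second φx≢β b≁x w (inj₂ v≡b)
        ... | no ¬Pv | no v≢b with u∈
        ...   | inj₁ Pu   = contradiction (inj (trans (proj₂ (crossing Pu ¬Pv e)) (sym φb≡β))) v≢b
        ...   | inj₂ refl = v , ¬Pv , v≢b , closed b v (b∈S φx≢β) e (λ { refl → b≁x b φb≡β e })

        bound : ∀ {g} → Gap x g → g + ∣ ⟦ P? ⟧ ∣ ≤ s
        bound at = ≤-trans (p⊆q⇒∣p∣≤∣q∣ inS) ∣S∣≤s
        bound (off φx≢β) = ≤-trans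
          (s≤s (p⊆q⇒∣p∣≤∣q∣ λ u∈ → x∈p∧x≢y⇒x∈p-y (inS u∈) (avoid u∈ ¬Pb)))
          (≤-trans (x∈p⇒∣p-x∣<∣p∣ (b∈S φx≢β)) ∣S∣≤s)
        bound (far φx≢β b≁x) with second φx≢β b≁x (connected b x) (inj₂ refl)
        ... | v , ¬Pv , v≢b , v∈S = ≤-trans
          (s≤s (s≤s (p⊆q⇒∣p∣≤∣q∣ λ u∈ → x∈p∧x≢y⇒x∈p-y (x∈p∧x≢y⇒x∈p-y (inS u∈) (avoid u∈ ¬Pb)) (avoid u∈ ¬Pv))))
          (≤-trans (s≤s (x∈p⇒∣p-x∣<∣p∣ (x∈p∧x≢y⇒x∈p-y v∈S v≢b)))
            (≤-trans (x∈p⇒∣p-x∣<∣p∣ (b∈S φx≢β)) ∣S∣≤s))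

-- Residues, and the windmill of cliques sharing one vertex.

residue≤ : ∀ q o d .{{_ : NonZero d}} → (q * d + o) % d ≤ o
residue≤ q o d = subst (_≤ o) (sym (trans (cong (_% d) (+-comm (q * d) o)) ([m+kn]%n≡m%n o q d))) (m%n≤m o d)

residue : ∀ q {o d} .{{_ : NonZero d}} → o < d → (q * d + o) % d ≡ o
residue q {o} {d} o<d = trans (cong (_% d) (+-comm (q * d) o)) (trans ([m+kn]%n≡m%n o q d) (m<n⇒m%n≡m o<d))

quotient-remainder : ∀ n d .{{_ : NonZero d}} → n ≡ n / d * d + n % d
quotient-remainder n d = trans (m≡m%n+[m/n]*n n d) (+-comm (n % d) _)

≤ᵇ≡true⇒≤ : ∀ {i j} → (i ≤ᵇ j) ≡ true → i ≤ j
≤ᵇ≡true⇒≤ {i} {j} e = ≤ᵇ⇒≤ i j (subst T (sym e) _)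

-- Vertex 0 is joined to everything; vertex j ≥ 1 has (j ∸ 1) % d predecessors in its clique.
module Windmill (d : ℕ) .{{_ : NonZero d}} where

  windmill : Rel
  windmill i j = (i ≡ᵇ 0) ∨ (j ≤ᵇ i + (j ∸ 1) % d)

  windmill⁻ : ∀ {i j} → i ≢ 0 → windmill i j ≡ true → j ≤ i + (j ∸ 1) % d
  windmill⁻ {zero}  i≢0 _ = contradiction refl i≢0
  windmill⁻ {suc i} _   e = ≤ᵇ≡true⇒≤ e

  windmill-connected : ∀ n → Connected (initialGraph windmill n)
  windmill-connected = connected-parents windmill λ i → 0 , z≤n , refl

  windmill-backDegree : ∀ q t → t < d → suc t ≤ backDegree windmill (1 + (q * d + t))
  windmill-backDegree q t t<d = backDegree-root-tail windmill (q * d) t refl λ o _ →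
    ≤⇒≤ᵇ≡true (s≤s (+-mono-≤ (m≤m+n (q * d) o) (≤-reflexive (sym (residue q t<d)))))

  -- For `j = suc (q * d) + o` the back-reach is at most `o`, even if `j` lies several cliques
  -- further on, so it never passes the boundary.
  windmill-cut : ∀ q {i j} → i < suc (q * d) → suc (q * d) ≤ j → ¬ j ≤ i + (j ∸ 1) % d
  windmill-cut q {i} i<s s≤j j≤ with m≤n⇒∃[o]m+o≡n s≤j
  ... | o , refl = <-irrefl refl (<-≤-trans (+-monoˡ-< o i<s) (≤-trans j≤ (+-monoʳ-≤ i (residue≤ q o d))))

  module _ {k : ℕ} (T : Graph k) (connected : Connected T) where

    open Tree T connected

    module _ {n} (f : Fin k → Fin n) (f-inj : Injective _≡_ _≡_ f)
             (hom : ∀ u v → Adj T u v → Adj (initialGraph windmill n) (f u) (f v)) where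

      private
        φ : Fin k → ℕ
        φ = toℕ ∘ f

        φ-inj : Injective _≡_ _≡_ φ
        φ-inj e = f-inj (toℕ-injective e)

        Inside : ℕ → Fin k → Set
        Inside q u = suc (q * d) ≤ φ u × φ u < suc (suc q * d)

        inside? : ∀ q → Decidable (Inside q)
        inside? q u = (suc (q * d) ≤? φ u) ×-dec (φ u <? suc (suc q * d))

        ∣inside∣≤d : ∀ q → ∣ ⟦ inside? q ⟧ ∣ ≤ d
        ∣inside∣≤d q = ∣p∣≤-of-interval φ-inj d (suc (q * d)) ⟦ inside? q ⟧ λ u u∈ →
          let lo , hi = ∈⟦⟧⁻ (inside? q) u∈
          in lo , subst (φ u <_) (cong suc (+-comm d (q * d))) hi

        block : Fin k → ℕ
        block u = (φ u ∸ 1) / d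

        own-block : ∀ u → φ u ≢ 0 → Inside (block u) u
        own-block u φu≢0 with φ u
        ... | zero  = contradiction refl φu≢0
        ... | suc i = s≤s (m/n*n≤m i d) , s≤s (subst (_< d + i / d * d) (sym (m≡m%n+[m/n]*n i d)) (+-monoˡ-< _ (m%n<n i d)))

        inside-closed : ∀ q {u v} → Inside q u → Adj T u v → φ v ≢ 0 → Inside q v
        inside-closed q {u} {v} (lo , hi) uv φv≢0 with joined⁻ windmill (hom u v uv)
        ... | inj₁ (u<v , r) = ≤-trans lo (<⇒≤ u<v) , ≰⇒> λ hi≤v →
                windmill-cut (suc q) hi hi≤v (windmill⁻ (λ φu≡0 → contradiction (subst (suc (q * d) ≤_) φu≡0 lo) λ ()) r)
        ... | inj₂ (v<u , r) = ≮⇒≥ (λ v<lo → windmill-cut q v<lo lo (windmill⁻ φv≢0 r)) , <-trans v<u hi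

      -- The vertex sent to the hub 0 is the one sought, with cliques as the closed sets. If none is
      -- sent there, connectedness confines `T` to one clique, too small for `d < k`.
      windmill-embedding⇒scattered : d < k → Σ (Fin k) (Scattered d)
      windmill-embedding⇒scattered d<k with any? (λ u → φ u ≟ 0)
      ... | yes (x , φx≡0) = x , λ y y≢x →
              ⟦ inside? (block y) ⟧
              , ∈⟦⟧⁺ (inside? (block y)) (own-block y (nonroot y≢x))
              , ∣inside∣≤d (block y)
              , λ u v u∈ uv v≢x → ∈⟦⟧⁺ (inside? (block y))
                  (inside-closed (block y) (∈⟦⟧⁻ (inside? (block y)) u∈) uv (nonroot v≢x))
        where
        nonroot : ∀ {y} → y ≢ x → φ y ≢ 0
        nonroot y≢x φy≡0 = y≢x (φ-inj (trans φy≡0 (sym φx≡0)))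
      ... | no none = contradiction k≤d (<⇒≱ d<k)
        where
        x₀ : Fin k
        x₀ = Fin.fromℕ< (≤-<-trans z≤n d<k)
        k≤d : k ≤ d
        k≤d = subst (_≤ d) (∣⊤∣≡n k) (≤-trans
          (p⊆q⇒∣p∣≤∣q∣ {p = full} {⟦ inside? (block x₀) ⟧} λ {u} _ → ∈⟦⟧⁺ (inside? (block x₀))
            (closed⇒full {Inside (block x₀)} (λ {_} {v} iu uv → inside-closed (block x₀) iu uv λ φv≡0 → none (v , φv≡0))
              {x₀} (own-block x₀ λ φx₀≡0 → none (x₀ , φx₀≡0)) u))
          (∣inside∣≤d (block x₀)))

-- Edges of the windmill.

2∑suc : ∀ n → 2 * ∑ suc n ≡ n * suc n
2∑suc zero    = refl
2∑suc (suc n) = trans (*-distribˡ-+ 2 (∑ suc n) (suc n)) (trans (cong (_+ 2 * suc n) (2∑suc n)) (step-identity n))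
  where
  step-identity : ∀ n → n * suc n + 2 * suc n ≡ suc n * suc (suc n)
  step-identity = solve-∀

module _ (p : ℕ) where

  private
    m d : ℕ
    m = suc p
    d = 2 * m

  open Windmill d

  -- A full clique with its edges to the hub has `m * suc d` edges, a surplus of `m`. The hub lacks
  -- `m` and the incomplete clique at most `m * p`, together `m * m`; so `m` full cliques suffice,
  -- whence the threshold.
  windmill-edges : ∀ n → 1 + m * d ≤ n → m * n ≤ edges (initialGraph windmill n)
  windmill-edges (suc i) (s≤s md≤i) = begin
    m * suc i                                       ≡⟨ cong (λ i → m * suc i) i≡ ⟩
    m * (1 + (q * d + r))                           ≡⟨ expand m q d r ⟩
    m + q * (m * d) + m * r                         ≤⟨ +-monoʳ-≤ (m + q * (m * d)) (prefix-deficit p suc d (λ _ → s≤s z≤n) (λ t m≤t _ → m≤n⇒m≤1+n m≤t) r (<⇒≤ (m%n<n i d))) ⟩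
    m + q * (m * d) + (∑ suc r + m * p)             ≡⟨ regroup p q d (∑ suc r) ⟩
    m * m + (q * (m * d) + ∑ suc r)                 ≤⟨ +-monoˡ-≤ _ (*-monoˡ-≤ m m≤q) ⟩
    q * m + (q * (m * d) + ∑ suc r)                 ≡⟨ collect q m d (∑ suc r) ⟩
    q * (m * suc d) + ∑ suc r                       ≡⟨ cong (λ x → q * x + ∑ suc r) (sym ∑suc-d) ⟩
    q * ∑ suc d + ∑ suc r                           ≤⟨ m≤n+m _ (∑ (backDegree windmill) 1) ⟩
    ∑ (backDegree windmill) 1 + (q * ∑ suc d + ∑ suc r)
      ≤⟨ ∑-periodic (backDegree windmill) suc 1 d q r (<⇒≤ (m%n<n i d)) windmill-backDegree ⟩
    ∑ (backDegree windmill) (1 + (q * d + r))       ≡⟨ cong (λ i → ∑ (backDegree windmill) (suc i)) (sym i≡) ⟩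
    ∑ (backDegree windmill) (suc i)                 ≤⟨ ∑-backDegree≤edges windmill (suc i) ⟩
    edges (initialGraph windmill (suc i))           ∎
    where
    open ≤-Reasoning
    q r : ℕ
    q = i / d
    r = i % d
    i≡ : i ≡ q * d + r
    i≡ = quotient-remainder i d
    m≤q : m ≤ q
    m≤q = subst (_≤ q) (m*n/n≡m m d) (/-monoˡ-≤ d md≤i)
    ∑suc-d : ∑ suc d ≡ m * suc d
    ∑suc-d = *-cancelˡ-≡ _ _ 2 (trans (2∑suc d) (*-assoc 2 m (suc d)))
    expand : ∀ m q d r → m * (1 + (q * d + r)) ≡ m + q * (m * d) + m * r
    expand = solve-∀
    regroup : ∀ p q d x → suc p + q * (suc p * d) + (x + suc p * p) ≡ suc p * suc p + (q * (suc p * d) + x)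
    regroup = solve-∀
    collect : ∀ q m d x → q * m + (q * (m * d) + x) ≡ q * (m * suc d) + x
    collect = solve-∀

-- The chain of blocks and its edges.

module Chain (p : ℕ) where

  -- `w` is 2m - 1, spelled so that `d` reduces to `suc w`. The first block has `A`, that is 4m - 1,
  -- vertices and each later one `c`.
  m w d c A : ℕ
  m = suc p
  w = p + suc (p + 0)
  d = 2 * m
  c = suc d
  A = w + d

  h b : ℕ → ℕ
  h t = 1 ⊔ (t ⊓ w)
  b j = if j <ᵇ A then j else h ((j ∸ A) % c)

  -- The back-neighbours of j are the b j vertices just before it: inside a block of c vertices these are all earlier ones, except that the
  -- last vertex misses the first (t ⊓ w) and that the first is linked to the end of the previous block (1 ⊔ …).
  chain : Rel
  chain i j = j ≤ᵇ i + b j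

  1≤w : 1 ≤ w
  1≤w = ≤-trans (s≤s z≤n) (m≤n+m (suc (p + 0)) p)

  b-first : ∀ {j} → j < A → b j ≡ j
  b-first j<A rewrite <⇒<ᵇ≡true j<A = refl

  b-later : ∀ n → b (A + n) ≡ h (n % c)
  b-later n rewrite dec-false (A + n <? A) (m+n≮m A n) | m+n∸m≡n A n = refl

  1≤b-suc : ∀ i → 1 ≤ b (suc i)
  1≤b-suc i with suc i <ᵇ A
  ... | true  = s≤s z≤n
  ... | false = m≤m⊔n 1 ((suc i ∸ A) % c ⊓ w)

  chain-connected : ∀ n → Connected (initialGraph chain n)
  chain-connected = connected-parents chain λ i → i , ≤-refl ,
    ≤⇒≤ᵇ≡true (subst (_≤ i + b (suc i)) (+-comm i 1) (+-monoʳ-≤ i (1≤b-suc i)))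

  b-from-boundary : ∀ q o → b (A + q * c + o) ≡ h ((q * c + o) % c)
  b-from-boundary q o = trans (cong b (+-assoc A (q * c) o)) (b-later (q * c + o))

  -- At distance `o` past the boundary the back-reach is at most `1 ⊔ o`: it crosses only for
  -- `o = 0`, and then by a single vertex.
  chain-cut : ∀ q {i j} → i < A + q * c → A + q * c ≤ j → chain i j ≡ true → suc i ≡ A + q * c × j ≡ A + q * c
  chain-cut q {i} i<s s≤j e with m≤n⇒∃[o]m+o≡n s≤j
  ... | o , refl = only o (≤-trans (≤ᵇ≡true⇒≤ e) (+-monoʳ-≤ i (≤-trans (≤-reflexive (b-from-boundary q o))
                     (⊔-monoʳ-≤ 1 (≤-trans (m⊓n≤m _ w) (residue≤ q o c))))))
    where
    only : ∀ o → A + q * c + o ≤ i + (1 ⊔ o) → suc i ≡ A + q * c × A + q * c + o ≡ A + q * c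
    only zero    le = ≤-antisym i<s (subst (_≤ suc i) (+-identityʳ _) (≤-trans le (≤-reflexive (+-comm i 1)))) , +-identityʳ _
    only (suc o) le = contradiction (+-cancelʳ-≤ (suc o) _ _ le) (<⇒≱ i<s)

  chain-ends : ∀ q → chain (A + q * c) (A + q * c + d) ≢ true
  chain-ends q e = <-irrefl refl (≤-trans (+-cancelˡ-≤ (A + q * c) _ _ (≤ᵇ≡true⇒≤ e)) (≤-reflexive bd≡w))
    where
    bd≡w : b (A + q * c + d) ≡ w
    bd≡w = begin
      b (A + q * c + d)      ≡⟨ b-from-boundary q d ⟩
      h ((q * c + d) % c)    ≡⟨ cong h (residue q ≤-refl) ⟩
      1 ⊔ (d ⊓ w)            ≡⟨ cong (1 ⊔_) (m≥n⇒m⊓n≡n (n≤1+n w)) ⟩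
      1 ⊔ w                  ≡⟨ m≤n⇒m⊔n≡n 1≤w ⟩
      w                      ∎
      where open ≡-Reasoning

  chain-backDegree : ∀ j → b j ≤ j → b j ≤ backDegree chain j
  chain-backDegree j bj≤j = subst (λ i → b j ≤ backDegree chain i) (m∸n+n≡m bj≤j)
    (backDegree-tail chain (j ∸ b j) (b j) λ t _ → subst (λ i → chain (j ∸ b j + t) i ≡ true) (sym (m∸n+n≡m bj≤j))
      (≤⇒≤ᵇ≡true (begin
        j                      ≡⟨ sym (m∸n+n≡m bj≤j) ⟩
        j ∸ b j + b j          ≤⟨ +-monoˡ-≤ (b j) (m≤m+n _ t) ⟩
        j ∸ b j + t + b j      ∎)))
    where open ≤-Reasoning

  backDegree-first : ∀ j → j < A → j ≤ backDegree chain j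
  backDegree-first j j<A = subst (_≤ backDegree chain j) (b-first j<A) (chain-backDegree j (≤-reflexive (b-first j<A)))

  h≤w : ∀ t → h t ≤ w
  h≤w t = ⊔-lub 1≤w (m⊓n≤n t w)

  backDegree-later : ∀ q t → t < c → h t ≤ backDegree chain (A + (q * c + t))
  backDegree-later q t t<c = subst (_≤ backDegree chain (A + (q * c + t))) b≡
    (chain-backDegree (A + (q * c + t)) (≤-trans (≤-reflexive b≡) (≤-trans (h≤w t) (≤-trans (m≤m+n w d) (m≤m+n A _)))))
    where
    b≡ : b (A + (q * c + t)) ≡ h t
    b≡ = trans (b-later (q * c + t)) (cong h (residue q t<c))

  -- Up to `w`, `h` is the identity except for `h 0 = 1`, which adds 2 to twice the triangular
  -- number.
  2∑h : ∀ n → n ≤ w → 2 * ∑ h (suc n) ≡ 2 + n * suc n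
  2∑h zero    _    = refl
  2∑h (suc n) n<w  = begin
    2 * (∑ h (suc n) + h (suc n))      ≡⟨ *-distribˡ-+ 2 (∑ h (suc n)) (h (suc n)) ⟩
    2 * ∑ h (suc n) + 2 * h (suc n)    ≡⟨ cong₂ (λ x y → x + 2 * y) (2∑h n (<⇒≤ n<w)) (cong (1 ⊔_) (m≤n⇒m⊓n≡m n<w)) ⟩
    2 + n * suc n + 2 * suc n          ≡⟨ step-identity n ⟩
    2 + suc n * suc (suc n)            ∎
    where
    open ≡-Reasoning
    step-identity : ∀ n → 2 + n * suc n + 2 * suc n ≡ 2 + suc n * suc (suc n)
    step-identity = solve-∀

  -- The link to the previous block replaces the deleted edge, so a block counts as many edges as a
  -- clique on 2m + 1 vertices.
  ∑h-block : ∑ h c ≡ m * c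
  ∑h-block = *-cancelˡ-≡ _ _ 2 (begin
    2 * (∑ h (suc w) + h (suc w))      ≡⟨ *-distribˡ-+ 2 (∑ h (suc w)) (h (suc w)) ⟩
    2 * ∑ h (suc w) + 2 * h (suc w)    ≡⟨ cong₂ (λ x y → x + 2 * y) (2∑h w ≤-refl) (trans (cong (1 ⊔_) (m≥n⇒m⊓n≡n (n≤1+n w))) (m≤n⇒m⊔n≡n 1≤w)) ⟩
    2 + w * suc w + 2 * w              ≡⟨ identity p ⟩
    2 * (m * c)                        ∎)
    where
    open ≡-Reasoning
    identity : ∀ p → 2 + (p + suc (p + 0)) * suc (p + suc (p + 0)) + 2 * (p + suc (p + 0)) ≡ 2 * (suc p * suc (2 * suc p))
    identity = solve-∀

  -- The surplus of the first clique is (4m - 1)(m - 1), enough for the `m * p` that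
  -- `prefix-deficit` allows the last block to lack. The slack `6 * p * p + 4 * p` is twice the
  -- difference.
  first-surplus : m * A + m * p ≤ ∑ id A
  first-surplus = *-cancelˡ-≤ 2 (begin
    2 * (m * A + m * p)                                            ≤⟨ m≤m+n _ (6 * p * p + 4 * p) ⟩
    2 * (m * A + m * p) + (6 * p * p + 4 * p)                      ≡⟨ identity p ⟩
    (2 + 4 * p) * suc (2 + 4 * p)                                  ≡⟨ sym (2∑id (2 + 4 * p)) ⟩
    2 * ∑ id (suc (2 + 4 * p))                                     ≡⟨ cong (λ a → 2 * ∑ id a) (A≡ p) ⟩
    2 * ∑ id A                                                     ∎)
    where
    open ≤-Reasoning
    A≡ : ∀ p → suc (2 + 4 * p) ≡ p + suc (p + 0) + 2 * suc p
    A≡ = solve-∀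
    2∑id : ∀ n → 2 * ∑ id (suc n) ≡ n * suc n
    2∑id n = trans (cong (2 *_) (∑-split id 1 n)) (2∑suc n)
    identity : ∀ p → 2 * (suc p * (p + suc (p + 0) + 2 * suc p) + suc p * p) + (6 * p * p + 4 * p) ≡ (2 + 4 * p) * suc (2 + 4 * p)
    identity = solve-∀

  h-late : ∀ t → m ≤ t → t < c → m ≤ h t
  h-late t m≤t _ = ≤-trans (⊓-glb m≤t m≤w) (m≤n⊔m 1 (t ⊓ w))
    where
    m≤w : m ≤ w
    m≤w = subst (_≤ w) (+-comm p 1) (+-monoʳ-≤ p (s≤s z≤n))

  chain-edges : ∀ n → A ≤ n → m * n ≤ edges (initialGraph chain n)
  chain-edges n A≤n = begin
    m * n                                           ≡⟨ cong (m *_) n≡ ⟩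
    m * (A + (q * c + r))                           ≡⟨ expand m A q c r ⟩
    m * A + (q * (m * c) + m * r)                   ≤⟨ +-monoʳ-≤ (m * A) (+-monoʳ-≤ (q * (m * c)) (prefix-deficit p h c (λ t → m≤m⊔n 1 (t ⊓ w)) h-late r r≤c)) ⟩
    m * A + (q * (m * c) + (∑ h r + m * p))         ≡⟨ regroup (m * A) (q * (m * c)) (∑ h r) (m * p) ⟩
    m * A + m * p + (q * (m * c) + ∑ h r)           ≡⟨ cong (λ x → m * A + m * p + (q * x + ∑ h r)) (sym ∑h-block) ⟩
    m * A + m * p + (q * ∑ h c + ∑ h r)             ≤⟨ +-monoˡ-≤ _ (≤-trans first-surplus (∑-mono-≤ A backDegree-first)) ⟩
    ∑ (backDegree chain) A + (q * ∑ h c + ∑ h r)    ≤⟨ ∑-periodic (backDegree chain) h A c q r r≤c backDegree-later ⟩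
    ∑ (backDegree chain) (A + (q * c + r))          ≡⟨ cong (∑ (backDegree chain)) (sym n≡) ⟩
    ∑ (backDegree chain) n                          ≤⟨ ∑-backDegree≤edges chain n ⟩
    edges (initialGraph chain n)                    ∎
    where
    open ≤-Reasoning
    q r : ℕ
    q = (n ∸ A) / c
    r = (n ∸ A) % c
    r≤c : r ≤ c
    r≤c = <⇒≤ (m%n<n (n ∸ A) c)
    n≡ : n ≡ A + (q * c + r)
    n≡ = trans (sym (m+[n∸m]≡n A≤n)) (cong (A +_) (quotient-remainder (n ∸ A) c))
    expand : ∀ m A q c r → m * (A + (q * c + r)) ≡ m * A + (q * (m * c) + m * r)
    expand = solve-∀
    regroup : ∀ a b x e → a + (b + (x + e)) ≡ a + e + (b + x)
    regroup = solve-∀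

  -- Embeddings into the chain.

  module _ {k : ℕ} (T : Graph k) (connected : Connected T) where

    open Tree T connected

    module _ {n} (f : Fin k → Fin n) (f-inj : Injective _≡_ _≡_ f)
             (hom : ∀ u v → Adj T u v → Adj (initialGraph chain n) (f u) (f v))
             (x : Fin k) (scattered : Scattered d x) where

      private
        φ : Fin k → ℕ
        φ = toℕ ∘ f

        φ-inj : Injective _≡_ _≡_ φ
        φ-inj e = f-inj (toℕ-injective e)

        left? : ∀ s → Decidable (λ u → φ u < s)
        left? s u = φ u <? s

        right? : ∀ s → Decidable (λ u → s ≤ φ u)
        right? s u = s ≤? φ u

        middle? : ∀ s e → Decidable (λ u → s ≤ φ u × φ u < e)
        middle? s e u = (s ≤? φ u) ×-dec (φ u <? e)

        2≤d : 2 ≤ d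
        2≤d = *-monoʳ-≤ 2 (s≤s (z≤n {p}))

        boundary : ℕ → ℕ
        boundary q = A + q * c

        crosses : ∀ q {u v} → φ u < boundary q → boundary q ≤ φ v → Adj T u v →
          suc (φ u) ≡ boundary q × φ v ≡ boundary q
        crosses q {u} {v} u<s s≤v uv with joined⁻ chain (hom u v uv)
        ... | inj₁ (_ , r)   = chain-cut q u<s s≤v r
        ... | inj₂ (v<u , _) = contradiction (<-trans v<u u<s) (≤⇒≯ s≤v)

        left-bound : ∀ q {g} → boundary q ≤ φ x → Side.Gap φ-inj (boundary q ∸ 1) (boundary q) x g →
          g + ∣ ⟦ left? (boundary q) ⟧ ∣ ≤ d
        left-bound q s≤x = Side.side-bound φ-inj _ _ (left? (boundary q)) (≤⇒≯ s≤x)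
          (λ u<s v≮s uv → let su≡s , v≡s = crosses q u<s (≮⇒≥ v≮s) uv in cong (_∸ 1) su≡s , v≡s)
          scattered 2≤d

        right-bound : ∀ q {g} → φ x < boundary q → Side.Gap φ-inj (boundary q) (boundary q ∸ 1) x g →
          g + ∣ ⟦ right? (boundary q) ⟧ ∣ ≤ d
        right-bound q x<s = Side.side-bound φ-inj _ _ (right? (boundary q)) (<⇒≱ x<s)
          (λ s≤u s≰v uv → let sv≡s , u≡s = crosses q (≰⇒> s≰v) s≤u (Adj-sym uv) in u≡s , cong (_∸ 1) sv≡s)
          scattered 2≤d

        three-parts : ∀ s e → k ≤ ∣ ⟦ left? s ⟧ ∣ + (∣ ⟦ middle? s e ⟧ ∣ + ∣ ⟦ right? e ⟧ ∣)
        three-parts s e = begin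
          k                                             ≡⟨ sym (∣⊤∣≡n k) ⟩
          ∣ full {k} ∣                                  ≤⟨ p⊆q⇒∣p∣≤∣q∣ {p = full} (λ {u} _ → cover u) ⟩
          ∣ L ∪ (M ∪ R) ∣                               ≤⟨ ∣p∪q∣≤∣p∣+∣q∣ L (M ∪ R) ⟩
          ∣ L ∣ + ∣ M ∪ R ∣                             ≤⟨ +-monoʳ-≤ ∣ L ∣ (∣p∪q∣≤∣p∣+∣q∣ M R) ⟩
          ∣ L ∣ + (∣ M ∣ + ∣ R ∣)                       ∎
          where
          open ≤-Reasoning
          L = ⟦ left? s ⟧
          M = ⟦ middle? s e ⟧
          R = ⟦ right? e ⟧
          cover : ∀ u → u ∈ L ∪ (M ∪ R)
          cover u with φ u <? s | e ≤? φ u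
          ... | yes u<s | _       = x∈p∪q⁺ (inj₁ (∈⟦⟧⁺ (left? s) u<s))
          ... | no _    | yes e≤u = x∈p∪q⁺ {p = L} (inj₂ (x∈p∪q⁺ {p = M} (inj₂ (∈⟦⟧⁺ (right? e) e≤u))))
          ... | no u≮s  | no e≰u  = x∈p∪q⁺ {p = L} (inj₂ (x∈p∪q⁺ {p = M} (inj₁ (∈⟦⟧⁺ (middle? s e) (≮⇒≥ u≮s , ≰⇒> e≰u)))))

        first-block : φ x < A → k < 3 * d
        first-block x<A = begin-strict
          k                                    ≤⟨ three-parts 0 A ⟩
          ∣ ⟦ left? 0 ⟧ ∣ + (∣ ⟦ middle? 0 A ⟧ ∣ + ∣ ⟦ right? A ⟧ ∣)
            -- With left boundary 0 the left part is empty.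
            ≤⟨ +-mono-≤ (≤-reflexive (Empty⇒∣p∣≡0 λ u u∈ → contradiction (∈⟦⟧⁻ (left? 0) u∈) λ ()))
                 (+-mono-≤ (∣p∣≤-of-interval φ-inj A 0 ⟦ middle? 0 A ⟧ λ u u∈ → ∈⟦⟧⁻ (middle? 0 A) u∈)
                   (subst (λ s → ∣ ⟦ right? s ⟧ ∣ ≤ d) (+-identityʳ A) (right-bound 0 (subst (φ x <_) (sym (+-identityʳ A)) x<A) Side.at))) ⟩
          w + d + d                            <⟨ ≤-reflexive (identity w) ⟩
          3 * d                                ∎
          where
          open ≤-Reasoning
          identity : ∀ w → suc (w + suc w + suc w) ≡ 3 * suc w
          identity = solve-∀

        later-block : ∀ q t → t < c → φ x ≡ boundary q + t → k < 3 * d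
        later-block q t t<c φx≡ = begin
          suc k                                ≤⟨ s≤s (three-parts s e) ⟩
          suc (L + (∣ ⟦ middle? s e ⟧ ∣ + R))  ≤⟨ s≤s (+-monoʳ-≤ L (+-monoˡ-≤ R ∣middle∣≤c)) ⟩
          -- The strict inequality and `c = suc d` each cost one, hence the 2 to be gained from the
          -- sides.
          suc (L + (c + R))                    ≡⟨ regroup L d R ⟩
          d + (2 + (L + R))                    ≤⟨ +-monoʳ-≤ d sides ⟩
          d + (d + d)                          ≡⟨ cong (λ x → d + (d + x)) (sym (+-identityʳ d)) ⟩
          3 * d                                ∎
          where
          open ≤-Reasoning
          s e L R : ℕ
          s = boundary q
          e = boundary (suc q)
          L = ∣ ⟦ left? s ⟧ ∣
          R = ∣ ⟦ right? e ⟧ ∣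
          s+c≡e : s + c ≡ e
          s+c≡e = trans (+-assoc A (q * c) c) (cong (A +_) (+-comm (q * c) c))
          last≡ : e ∸ 1 ≡ s + d
          last≡ = cong (_∸ 1) (trans (sym s+c≡e) (+-suc s d))
          ∣middle∣≤c : ∣ ⟦ middle? s e ⟧ ∣ ≤ c
          ∣middle∣≤c = ∣p∣≤-of-interval φ-inj c s ⟦ middle? s e ⟧ λ u u∈ →
            let lo , hi = ∈⟦⟧⁻ (middle? s e) u∈ in lo , subst (φ u <_) (sym s+c≡e) hi
          regroup : ∀ L d R → suc (L + (suc d + R)) ≡ d + (2 + (L + R))
          regroup = solve-∀
          s≤x : s ≤ φ x
          s≤x = subst (s ≤_) (sym φx≡) (m≤m+n s t)
          x<e : φ x < e
          x<e = subst₂ _<_ (sym φx≡) s+c≡e (+-monoʳ-< s t<c)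
          ends-nonadjacent : ∀ {u v} → φ u ≡ s → φ v ≡ s + d → ¬ Adj T u v
          ends-nonadjacent {u} {v} u≡ v≡ uv with joined⁻ chain (hom u v uv)
          ... | inj₁ (_ , r)   = chain-ends q (subst₂ (λ i j → chain i j ≡ true) u≡ v≡ r)
          ... | inj₂ (v<u , _) = contradiction (subst₂ _<_ v≡ u≡ v<u) (m+n≮m s d)
          -- The gaps on the left and right always add up to 2: 0 and 2 if `x` is first in its
          -- block, 2 and 0 if last, 1 and 1 otherwise.
          sides : 2 + (L + R) ≤ d + d
          sides with t ≟ 0 | t ≟ d
          ... | yes refl | _ = subst (_≤ d + d) (shift L R)
                (+-mono-≤ (left-bound q s≤x Side.at)
                  (right-bound (suc q) x<e (Side.far
                    (λ x≡ → m+1+n≢m s (sym (+-cancel-eq x≡)))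
                    (λ b b≡ bx → ends-nonadjacent (trans φx≡ (+-identityʳ s)) (trans b≡ last≡) (Adj-sym bx)))))
            where
            shift : ∀ L R → L + (2 + R) ≡ 2 + (L + R)
            shift = solve-∀
            +-cancel-eq : φ x ≡ e ∸ 1 → s ≡ s + d
            +-cancel-eq x≡ = trans (sym (+-identityʳ s)) (trans (sym φx≡) (trans x≡ last≡))
          ... | no t≢0 | yes refl =
                +-mono-≤ (left-bound q s≤x (Side.far
                    (λ x≡ → t≢0 (+-cancelˡ-≡ s d 0 (trans (sym φx≡) (trans x≡ (sym (+-identityʳ s))))))
                    (λ b b≡ bx → ends-nonadjacent b≡ φx≡ bx)))
                  (right-bound (suc q) x<e Side.at)
          ... | no t≢0 | no t≢d = subst (_≤ d + d) (shift L R)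
                (+-mono-≤ (left-bound q s≤x (Side.off λ x≡ → t≢0 (+-cancelˡ-≡ s t 0 (trans (sym φx≡) (trans x≡ (sym (+-identityʳ s)))))))
                  (right-bound (suc q) x<e (Side.off λ x≡ → t≢d (+-cancelˡ-≡ s t d (trans (sym φx≡) (trans x≡ last≡))))))
            where
            shift : ∀ L R → suc L + suc R ≡ 2 + (L + R)
            shift = solve-∀

      chain-embedding⇒small : k < 3 * d
      chain-embedding⇒small with φ x <? A
      ... | yes x<A = first-block x<A
      ... | no  x≮A = later-block ((φ x ∸ A) / c) ((φ x ∸ A) % c) (m%n<n (φ x ∸ A) c)
              (trans (sym (m+[n∸m]≡n (≮⇒≥ x≮A)))
                (trans (cong (A +_) (quotient-remainder (φ x ∸ A) c)) (sym (+-assoc A _ _))))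

-- Choosing between chain and windmill.

theorem3p1 : (k : ℕ) (T : Graph k) → IsTree T →
    Σ ℕ λ N → (n : ℕ) → N ≤ n → ExcAtLeast n T ((k / 6) * n)
theorem3p1 k T (connected , _) with k / 6 | m/n*n≤m k 6
-- A zero bound holds by the convention in `ExcAtLeast`.
... | zero  | _ = 0 , λ _ _ → inj₁ refl
... | suc p | 6m≤k with any? (Tree.scattered? T connected (2 * suc p))
-- From `A` vertices on, the first block is complete.
...   | yes (x , scattered) = A , λ n A≤n → inj₂
          ( initialGraph chain n , chain-connected n
          , (λ (f , inj , hom) → <⇒≱ (chain-embedding⇒small T connected f inj hom x scattered) 3d≤k)
          , chain-edges n A≤n)
  where
  open Chain p
  3d≤k : 3 * (2 * suc p) ≤ k
  3d≤k = subst (_≤ k) (identity p) 6m≤k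
    where
    identity : ∀ p → suc p * 6 ≡ 3 * (2 * suc p)
    identity = solve-∀
-- The hub and `m` full cliques.
...   | no none = 1 + suc p * (2 * suc p) , λ n N≤n → inj₂
          ( initialGraph windmill n , windmill-connected n
          , (λ (f , inj , hom) → none (windmill-embedding⇒scattered T connected f inj hom d<k))
          , windmill-edges p n N≤n)
  where
  open Windmill (2 * suc p)
  d<k : 2 * suc p < k
  d<k = <-≤-trans (subst (2 * suc p <_) (identity p) (m≤m+n _ (4 * p + 3))) 6m≤k
    where
    identity : ∀ p → suc (2 * suc p) + (4 * p + 3) ≡ suc p * 6
    identity = solve-∀
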